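{- An element $x$ of a continuous dcpo $D$ is strongly maximal if and only if $x$ is sharp and every Lawson neighbourhood of $x$ contains a Scott neighbourhood of $x$.
   Context: Everything is constructive: neither excluded middle nor choice is assumed. A subset $S$ of a poset is directed if it is inhabited and any two elements of $S$ have an upper bound in $S$. A dcpo is a poset $(D,\sqsubseteq)$ in which every directed subset $S$ has a supremum $\bigsqcup S$. Write $x\ll y$ ($x$ is way below $y$) if for every directed $S$ with $y\sqsubseteq\bigsqcup S$ there is $s\in S$ with $x\sqsubseteq s$. $D$ is continuous if for every $x$ the set $\{y\in D\mid y\ll x\}$ is directed with supremum $x$. A subset $U\subseteq D$ is Scott open if it is an upper set and whenever $\bigsqcup S\in U$ with $S$ directed, some $s\in S$ is in $U$. Two points of $D$ are Hausdorff separated if they have disjoint Scott open neighbourhoods. An element $x$ of a continuous dcpo $D$ is strongly maximal if for every $u,v\in D$ with $u\ll v$, we have $u\ll x$, or $v$ and $x$ are Hausdorff separated. An element $x\in D$ is sharp if for every $y,z\in D$ with $y\ll z$ we have $y\ll x$ or $\lnot(z\sqsubseteq x)$. Write $x\not\sqsubseteq^{+}y$ if there is a Scott open set containing $x$ but not $y$. The Lawson topology on $D$ is the topology generated by the following subbasic opens: the Scott open sets, and the sets $\{y\in D\mid x\not\sqsubseteq^{+}y\}$ for $x\in D$. A Lawson (respectively Scott) neighbourhood of $x$ is a neighbourhood of $x$ in the Lawson (respectively Scott) topology. -}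

module Defs where

-- Propositions are types and a subset of X : Set c is a predicate Pred X c.
-- The intended metatheory is impredicative (one powerset, closed under
-- comprehension), whereas universes here are predicative: _≪_ and _⋢⁺_
-- quantify over all subsets and so land in a higher universe.  Wherever a set
-- defined from them has to be an element of the powerset, it is a V : Pred X c
-- with the same elements (V ≐ …).  Impredicatively such a V always exists.

open import Data.List.Base using (List; foldr)
open import Data.List.Relation.Unary.All using (All)
open import Data.Product.Base using (∃; _×_)
open import Data.Sum.Base using (_⊎_)
open import Level using (Level; _⊔_; suc)
open import Relation.Binary.Bundles using (Poset)
open import Relation.Nullary.Negation.Core using (¬_)
open import Relation.Unary using (Pred; Satisfiable; _∈_; _∉_; _⊆_; _≐_; _∩_; _⊥_)
open import Relation.Unary.Polymorphic using (U)

private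
  variable
    c ℓ ℓ₁ ℓ₂ : Level

⋂ₗ : {X : Set c} → List (Pred X c) → Pred X c
⋂ₗ = foldr _∩_ U

-- A topology on X is represented by its predicate of open sets, and the one
-- generated by a subbasis has as opens the unions of finite intersections of
-- subbasic sets.

Generated : {X : Set c} → Pred (Pred X c) ℓ → Pred (Pred X c) (suc c ⊔ ℓ)
Generated {c = c} {X = X} Subbasic O =
  ∀ {x} → x ∈ O →
  ∃ λ (Bs : List (Pred X c)) →
    All Subbasic Bs × x ∈ ⋂ₗ Bs × ⋂ₗ Bs ⊆ O

IsNeighbourhood : {X : Set c} → Pred (Pred X c) ℓ → X → Pred (Pred X c) (suc c ⊔ ℓ)
IsNeighbourhood Open x N = ∃ λ O → Open O × x ∈ O × O ⊆ N

module _ (P : Poset c ℓ₁ ℓ₂) where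
  open Poset P

  Directed : Pred Carrier ℓ → Set (c ⊔ ℓ₂ ⊔ ℓ)
  Directed S =
    Satisfiable S ×
    (∀ {x y} → x ∈ S → y ∈ S → ∃ λ z → z ∈ S × x ≤ z × y ≤ z)

  IsSupremum : Pred Carrier ℓ → Carrier → Set (c ⊔ ℓ₂ ⊔ ℓ)
  IsSupremum S x =
    (∀ {s} → s ∈ S → s ≤ x) ×
    (∀ {y} → (∀ {s} → s ∈ S → s ≤ y) → x ≤ y)

record DCPO c ℓ₁ ℓ₂ : Set (suc (c ⊔ ℓ₁ ⊔ ℓ₂)) where
  field
    poset : Poset c ℓ₁ ℓ₂

  open Poset poset public renaming (_≤_ to _⊑_)

  field
    ⨆          : (S : Pred Carrier c) → Directed poset S → Carrier
    ⨆-supremum : ∀ S (S-dir : Directed poset S) → IsSupremum poset S (⨆ S S-dir)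

module _ (D : DCPO c ℓ₁ ℓ₂) where
  open DCPO D

  infix 4 _≪_ _⋢⁺_

  _≪_ : Carrier → Carrier → Set (suc c ⊔ ℓ₂)
  x ≪ y = ∀ S (S-dir : Directed poset S) → y ⊑ ⨆ S S-dir → ∃ λ s → s ∈ S × x ⊑ s

  Continuous : Set (suc c ⊔ ℓ₂)
  Continuous = ∀ x → ∃ λ (S : Pred Carrier c) →
    S ≐ (_≪ x) × Directed poset S × IsSupremum poset S x

  ScottOpen : Pred (Pred Carrier c) (suc c ⊔ ℓ₂)
  ScottOpen O =
    (∀ {x y} → x ⊑ y → x ∈ O → y ∈ O) ×
    (∀ S (S-dir : Directed poset S) → ⨆ S S-dir ∈ O → ∃ λ s → s ∈ S × s ∈ O)

  HausdorffSeparated : Carrier → Carrier → Set (suc c ⊔ ℓ₂)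
  HausdorffSeparated x y = ∃ λ O → ∃ λ O′ →
    ScottOpen O × ScottOpen O′ × x ∈ O × y ∈ O′ × O ⊥ O′

  StronglyMaximal : Pred Carrier (suc c ⊔ ℓ₂)
  StronglyMaximal x = ∀ u v → u ≪ v → u ≪ x ⊎ HausdorffSeparated v x

  Sharp : Pred Carrier (suc c ⊔ ℓ₂)
  Sharp x = ∀ y z → y ≪ z → y ≪ x ⊎ ¬ (z ⊑ x)

  _⋢⁺_ : Carrier → Carrier → Set (suc c ⊔ ℓ₂)
  x ⋢⁺ y = ∃ λ O → ScottOpen O × x ∈ O × y ∉ O

  LawsonSubbasic : Pred (Pred Carrier c) (suc c ⊔ ℓ₂)
  LawsonSubbasic O = ScottOpen O ⊎ ∃ λ x → O ≐ (x ⋢⁺_)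

  LawsonOpen : Pred (Pred Carrier c) (suc c ⊔ ℓ₂)
  LawsonOpen = Generated LawsonSubbasic

{-# OPTIONS --safe #-}
module Submission where

-- (⇒) If y ⋢⁺ x, then some u ≪ y is not below x, so strong maximality
-- separates y from x, and the open set around x lies in {w ∣ y ⋢⁺ w}.
-- (⇐) Given u ≪ v, interpolate u ≪ w′ ≪ w ≪ v.  By sharpness, either u ≪ x or
-- w′ ⋢ x.  In the latter case w ⋢⁺ x, so some Scott open M ∋ x is contained in
-- {y ∣ w ⋢⁺ y}, and M is disjoint from the neighbourhood {y ∣ w ≪ y} of v.

open import Defs
open import Data.List.Base using ([]; _∷_)
open import Data.List.Relation.Unary.All using (All; []; _∷_)
open import Data.Product.Base using (∃; _×_; _,_; proj₁; proj₂)
open import Data.Sum.Base using (inj₁; inj₂)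
open import Function.Base using (id)
open import Function.Bundles using (_⇔_; mk⇔)
open import Level using (Level)
open import Relation.Binary.Definitions using (Trans)
open import Relation.Nullary.Negation using (¬_; contradiction)
open import Relation.Unary using (Pred; _∈_; _⊆_; _≐_; _∩_)
open import Relation.Unary.Polymorphic using (U)

private
  variable
    c ℓ₁ ℓ₂ : Level

module _ (D : DCPO c ℓ₁ ℓ₂) where
  open DCPO D

  private
    infix 4 _≪ᴰ_ _⋢⁺ᴰ_

    _≪ᴰ_ = _≪_ D
    _⋢⁺ᴰ_ = _⋢⁺_ D

  ≪-⊑-trans : Trans _≪ᴰ_ _⊑_ _≪ᴰ_
  ≪-⊑-trans x≪y y⊑z S S-dir z⊑⨆S = x≪y S S-dir (trans y⊑z z⊑⨆S)

  ⊑-≪-trans : Trans _⊑_ _≪ᴰ_ _≪ᴰ_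
  ⊑-≪-trans x⊑y y≪z S S-dir z⊑⨆S =
    let s , s∈S , y⊑s = y≪z S S-dir z⊑⨆S in s , s∈S , trans x⊑y y⊑s

  scottOpen-U : ScottOpen D U
  scottOpen-U = (λ _ _ → _) , λ where S ((s , s∈S) , _) _ → s , s∈S , _

  scottOpen-∩ : ∀ {O O′} → ScottOpen D O → ScottOpen D O′ → ScottOpen D (O ∩ O′)
  scottOpen-∩ {O} {O′} (up , inacc) (up′ , inacc′) =
    (λ x⊑y (x∈O , x∈O′) → up x⊑y x∈O , up′ x⊑y x∈O′) , inacc-∩
    where
    inacc-∩ : ∀ S (S-dir : Directed poset S) → ⨆ S S-dir ∈ O ∩ O′ →
              ∃ λ s → s ∈ S × s ∈ O ∩ O′
    inacc-∩ S S-dir (⨆∈O , ⨆∈O′) =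
      let s , s∈S , s∈O   = inacc S S-dir ⨆∈O
          t , t∈S , t∈O′  = inacc′ S S-dir ⨆∈O′
          r , r∈S , s⊑r , t⊑r = proj₂ S-dir s∈S t∈S
      in r , r∈S , up s⊑r s∈O , up′ t⊑r t∈O′

  ⋢⁺⇒⋢ : ∀ {x y} → x ⋢⁺ᴰ y → ¬ (x ⊑ y)
  ⋢⁺⇒⋢ (_ , (up , _) , x∈O , y∉O) x⊑y = y∉O (up x⊑y x∈O)

  separated⇒⋢⁺ : ∀ {x y} → HausdorffSeparated D x y → x ⋢⁺ᴰ y
  separated⇒⋢⁺ (O , _ , O-open , _ , x∈O , y∈O′ , O⊥O′) =
    O , O-open , x∈O , λ y∈O → O⊥O′ (y∈O , y∈O′)

  -- Scott open sets are upper, so one that contains `z` but not `x` rules out `z ⊑ x`.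
  stronglyMaximal⇒sharp : ∀ {x} → StronglyMaximal D x → Sharp D x
  stronglyMaximal⇒sharp sm y z y≪z with sm y z y≪z
  ... | inj₁ y≪x = inj₁ y≪x
  ... | inj₂ sep = inj₂ (⋢⁺⇒⋢ (separated⇒⋢⁺ sep))

  subbasic⇒lawsonOpen : ∀ {O} → LawsonSubbasic D O → LawsonOpen D O
  subbasic⇒lawsonOpen {O} O-sub x∈O = O ∷ [] , O-sub ∷ [] , (x∈O , _) , proj₁

  module _ (continuous : Continuous D) where

    -- The copy at level `c` of the elements way below `x`: suprema and open sets involve only
    -- predicates of that level, and `_≪_` lands above it.
    ↡ : Carrier → Pred Carrier c
    ↡ x = proj₁ (continuous x)

    ↟ : Carrier → Pred Carrier c
    ↟ x y = x ∈ ↡ y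

    ↡⇒≪ : ∀ {x y} → y ∈ ↡ x → y ≪ᴰ x
    ↡⇒≪ {x} = proj₁ (proj₁ (proj₂ (continuous x)))

    ≪⇒↡ : ∀ {x y} → y ≪ᴰ x → y ∈ ↡ x
    ≪⇒↡ {x} = proj₂ (proj₁ (proj₂ (continuous x)))

    ↡-directed : ∀ x → Directed poset (↡ x)
    ↡-directed x = proj₁ (proj₂ (proj₂ (continuous x)))

    ↡-supremum : ∀ x → IsSupremum poset (↡ x) x
    ↡-supremum x = proj₂ (proj₂ (proj₂ (continuous x)))

    ⊑⨆↡ : ∀ x → x ⊑ ⨆ (↡ x) (↡-directed x)
    ⊑⨆↡ x = proj₂ (↡-supremum x) (proj₁ (⨆-supremum (↡ x) (↡-directed x)))

    ≪⇒⊑ : ∀ {x y} → x ≪ᴰ y → x ⊑ y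
    ≪⇒⊑ {y = y} x≪y = proj₁ (↡-supremum y) (≪⇒↡ x≪y)

    ↡⊆↡⇒⊑ : ∀ {x y} → ↡ x ⊆ ↡ y → x ⊑ y
    ↡⊆↡⇒⊑ {x} {y} ↡x⊆↡y =
      proj₂ (↡-supremum x) λ s∈↡x → proj₁ (↡-supremum y) (↡x⊆↡y s∈↡x)

    ⊑⇒↡⊆↡ : ∀ {x y} → x ⊑ y → ↡ x ⊆ ↡ y
    ⊑⇒↡⊆↡ x⊑y s∈↡x = ≪⇒↡ (≪-⊑-trans (↡⇒≪ s∈↡x) x⊑y)

    -- The union of the sets `↡ y` over `y ≪ z` is directed and its supremum is above `z`, so
    -- `x ≪ z` can be applied to it.
    ≪-interpolate : ∀ {x z} → x ≪ᴰ z → ∃ λ y → x ≪ᴰ y × y ≪ᴰ z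
    ≪-interpolate {z = z} x≪z =
      let s , (y , s∈↡y , y∈↡z) , x⊑s = x≪z ↡↡z ↡↡z-directed z⊑⨆
      in y , ⊑-≪-trans x⊑s (↡⇒≪ s∈↡y) , ↡⇒≪ y∈↡z
      where
      ↡↡z : Pred Carrier c
      ↡↡z s = ∃ λ y → s ∈ ↡ y × y ∈ ↡ z

      ↡↡z-directed : Directed poset ↡↡z
      ↡↡z-directed =
        (let y , y∈↡z = proj₁ (↡-directed z)
             s , s∈↡y = proj₁ (↡-directed y)
         in s , y , s∈↡y , y∈↡z) ,
        λ (y , s∈↡y , y∈↡z) (y′ , s′∈↡y′ , y′∈↡z) →
          -- An upper bound `t` of `y` and `y′` puts both elements into the single directed set
          -- `↡ t`.
          let t , t∈↡z , y⊑t , y′⊑t = proj₂ (↡-directed z) y∈↡z y′∈↡z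
              r , r∈↡t , s⊑r , s′⊑r =
                proj₂ (↡-directed t) (⊑⇒↡⊆↡ y⊑t s∈↡y) (⊑⇒↡⊆↡ y′⊑t s′∈↡y′)
          in r , (t , r∈↡t , t∈↡z) , s⊑r , s′⊑r

      z⊑⨆ : z ⊑ ⨆ ↡↡z ↡↡z-directed
      z⊑⨆ = proj₂ (↡-supremum z) λ {y} y∈↡z →
        proj₂ (↡-supremum y) λ s∈↡y →
          proj₁ (⨆-supremum ↡↡z ↡↡z-directed) (y , s∈↡y , y∈↡z)

    -- Interpolating `x ≪ y ≪ ⨆ S` puts `y` below some member of `S`, which is then way above `x`.
    ↟-scottOpen : ∀ x → ScottOpen D (↟ x)
    ↟-scottOpen x = (λ y⊑z → ⊑⇒↡⊆↡ y⊑z) , λ S S-dir x∈↡⨆ →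
      let y , x≪y , y≪⨆ = ≪-interpolate (↡⇒≪ x∈↡⨆)
          s , s∈S , y⊑s = y≪⨆ S S-dir refl
      in s , s∈S , ≪⇒↡ (≪-⊑-trans x≪y y⊑s)

    scottOpen-≪ : ∀ {O x} → ScottOpen D O → x ∈ O → ∃ λ u → u ≪ᴰ x × u ∈ O
    scottOpen-≪ {x = x} (up , inacc) x∈O =
      -- `O` is inaccessible by directed suprema, and `x` lies below the supremum of `↡ x`.
      let u , u∈↡x , u∈O = inacc (↡ x) (↡-directed x) (up (⊑⨆↡ x) x∈O)
      in u , ↡⇒≪ u∈↡x , u∈O

    ≪-⋢⇒⋢⁺ : ∀ {u x y} → u ≪ᴰ x → ¬ (u ⊑ y) → x ⋢⁺ᴰ y
    ≪-⋢⇒⋢⁺ {u} u≪x u⋢y =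
      ↟ u , ↟-scottOpen u , ≪⇒↡ u≪x , λ u∈↡y → u⋢y (≪⇒⊑ (↡⇒≪ u∈↡y))

    -- {y ∣ x ⋢⁺ y} as an element of the powerset: u ⋢ y is expressed through
    -- ↡ because _⊑_ need not live in level c.
    ⋢⁺-set : Carrier → Pred Carrier c
    ⋢⁺-set x y = ∃ λ u → u ∈ ↡ x × ¬ (↡ u ⊆ ↡ y)

    ⋢⁺-set≐⋢⁺ : ∀ x → ⋢⁺-set x ≐ (x ⋢⁺ᴰ_)
    ⋢⁺-set≐⋢⁺ x =
      (λ (u , u∈↡x , ↡u⊈↡y) →
        ≪-⋢⇒⋢⁺ (↡⇒≪ u∈↡x) λ u⊑y → ↡u⊈↡y (⊑⇒↡⊆↡ u⊑y)) ,
      λ (O , O-open , x∈O , y∉O) →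
        -- If `↡ u ⊆ ↡ y`, then `u ⊑ y`, and the upper set `O` would contain `y`.
        let u , u≪x , u∈O = scottOpen-≪ O-open x∈O
        in u , ≪⇒↡ u≪x , λ ↡u⊆↡y → y∉O (proj₁ O-open (↡⊆↡⇒⊑ ↡u⊆↡y) u∈O)

    module _ {x : Carrier} where

      -- Choosing `u ≪ y` inside `O` excludes the alternative `u ≪ x`, which would put `x` into `O`.
      stronglyMaximal-⋢⁺⇒separated :
        StronglyMaximal D x → ∀ {y} → y ⋢⁺ᴰ x → HausdorffSeparated D y x
      stronglyMaximal-⋢⁺⇒separated sm {y} (O , O-open , y∈O , x∉O)
        with u , u≪y , u∈O ← scottOpen-≪ O-open y∈O
        with sm u y u≪y
      ... | inj₁ u≪x = contradiction (proj₁ O-open (≪⇒⊑ u≪x) u∈O) x∉O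
      ... | inj₂ sep = sep

      lawsonSubbasic⇒scottNeighbourhood :
        StronglyMaximal D x → ∀ {B} → LawsonSubbasic D B → x ∈ B →
        IsNeighbourhood (ScottOpen D) x B
      lawsonSubbasic⇒scottNeighbourhood sm {B} (inj₁ B-open) x∈B = B , B-open , x∈B , id
      lawsonSubbasic⇒scottNeighbourhood sm (inj₂ (y , B⊆ , ⊆B)) x∈B =
        let O , O′ , O-open , O′-open , y∈O , x∈O′ , O⊥O′ =
              stronglyMaximal-⋢⁺⇒separated sm (B⊆ x∈B)
        -- The one set `O` witnesses `y ⋢⁺ w` for every `w` in `O′`, by disjointness.
        in O′ , O′-open , x∈O′ , λ w∈O′ →
             ⊆B (O , O-open , y∈O , λ w∈O → O⊥O′ (w∈O , w∈O′))

      ⋂ₗ-scottNeighbourhood :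
        StronglyMaximal D x → ∀ {Bs} → All (LawsonSubbasic D) Bs → x ∈ ⋂ₗ Bs →
        IsNeighbourhood (ScottOpen D) x (⋂ₗ Bs)
      ⋂ₗ-scottNeighbourhood sm [] _ = U , scottOpen-U , _ , id
      ⋂ₗ-scottNeighbourhood sm (B-sub ∷ Bs-sub) (x∈B , x∈Bs) =
        let O , O-open , x∈O , O⊆B = lawsonSubbasic⇒scottNeighbourhood sm B-sub x∈B
            O′ , O′-open , x∈O′ , O′⊆Bs = ⋂ₗ-scottNeighbourhood sm Bs-sub x∈Bs
        in O ∩ O′ , scottOpen-∩ O-open O′-open , (x∈O , x∈O′) ,
           λ (w∈O , w∈O′) → O⊆B w∈O , O′⊆Bs w∈O′

      LawsonNeighbourhoodsContainScott : Set _
      LawsonNeighbourhoodsContainScott =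
        ∀ N → IsNeighbourhood (LawsonOpen D) x N →
        ∃ λ M → IsNeighbourhood (ScottOpen D) x M × M ⊆ N

      stronglyMaximal⇒lawsonNeighbourhoodsContainScott :
        StronglyMaximal D x → LawsonNeighbourhoodsContainScott
      stronglyMaximal⇒lawsonNeighbourhoodsContainScott sm N (O , O-open , x∈O , O⊆N) =
        let Bs , Bs-sub , x∈Bs , Bs⊆O = O-open x∈O
        in ⋂ₗ Bs , ⋂ₗ-scottNeighbourhood sm Bs-sub x∈Bs , λ w∈Bs → O⊆N (Bs⊆O w∈Bs)

      ≪-⋢⁺⇒separated : LawsonNeighbourhoodsContainScott →
        ∀ {w v} → w ≪ᴰ v → w ⋢⁺ᴰ x → HausdorffSeparated D v x
      ≪-⋢⁺⇒separated lawson {w} w≪v w⋢⁺x =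
        let N⊆ , ⊆N = ⋢⁺-set≐⋢⁺ w
            M , (O , O-open , x∈O , O⊆M) , M⊆N =
              lawson (⋢⁺-set w)
                ( ⋢⁺-set w
                , subbasic⇒lawsonOpen (inj₂ (w , ⋢⁺-set≐⋢⁺ w))
                , ⊆N w⋢⁺x
                , id)
        in ↟ w , O , ↟-scottOpen w , O-open , ≪⇒↡ w≪v , x∈O ,
           -- A common point `y` would satisfy both `w ⊑ y` and `w ⋢⁺ y`.
           λ (w∈↡y , y∈O) → ⋢⁺⇒⋢ (N⊆ (M⊆N (O⊆M y∈O))) (≪⇒⊑ (↡⇒≪ w∈↡y))

      sharp-lawson⇒stronglyMaximal :
        Sharp D x → LawsonNeighbourhoodsContainScott → StronglyMaximal D x
      sharp-lawson⇒stronglyMaximal sharp lawson u v u≪v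
        -- Two interpolants: `w ≪ v` makes `↟ w` a neighbourhood of `v`, and `w′ ≪ w` strengthens
        -- the bare negation `¬ (w′ ⊑ x)` given by sharpness to `w ⋢⁺ x`.
        with w , u≪w , w≪v ← ≪-interpolate u≪v
        with w′ , u≪w′ , w′≪w ← ≪-interpolate u≪w
        with sharp u w′ u≪w′
      ... | inj₁ u≪x = inj₁ u≪x
      ... | inj₂ w′⋢x = inj₂ (≪-⋢⁺⇒separated lawson w≪v (≪-⋢⇒⋢⁺ w′≪w w′⋢x))

theorem6p15 : ∀ {c ℓ₁ ℓ₂} (D : DCPO c ℓ₁ ℓ₂) → Continuous D → ∀ (x : DCPO.Carrier D) →
    StronglyMaximal D x ⇔
    (Sharp D x ×
    (∀ N → IsNeighbourhood (LawsonOpen D) x N →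
    ∃ λ M → IsNeighbourhood (ScottOpen D) x M × M ⊆ N))
theorem6p15 D continuous x = mk⇔
  (λ sm → stronglyMaximal⇒sharp D sm ,
          stronglyMaximal⇒lawsonNeighbourhoodsContainScott D continuous sm)
  (λ (sharp , lawson) → sharp-lawson⇒stronglyMaximal D continuous sharp lawson)
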